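{- $\mathsf{EL}_{K,\Box,B}$ is a sound and complete axiomatization of $\mathcal{L}_{K,\Box,B}$ with respect to the class of all topological subset spaces under epistemic-doxastic (e-d) semantics: for every $\varphi\in\mathcal{L}_{K,\Box,B}$, $\varphi$ is provable in $\mathsf{EL}_{K,\Box,B}$ if and only if $(\mathcal{X},x,U,V)\models\varphi$ for every topological subset model $\mathcal{X}$ and every e-d scenario $(x,U,V)$ of $\mathcal{X}$.
   Context: Language. Fix a countable set PROP of primitive propositions. $\mathcal{L}_{K,\Box,B}$ is generated by $\varphi ::= p \mid \neg\varphi \mid \varphi\wedge\psi \mid K\varphi\mid\Box\varphi\mid B\varphi$, $p\in$ PROP. The connectives $\vee,\to,\leftrightarrow$ are defined as usual. The logic $\mathsf{EL}_{K,\Box,B}$ is the Hilbert system (schemes and rules ranging over formulas of $\mathcal{L}_{K,\Box,B}$) consisting of classical propositional logic (with modus ponens) plus: the $\mathsf{S5}$ principles for $K$: $K(\varphi\to\psi)\to(K\varphi\to K\psi)$, $K\varphi\to\varphi$, $K\varphi\to KK\varphi$, $\neg K\varphi\to K\neg K\varphi$, and the rule "from $\vdash\varphi$ infer $\vdash K\varphi$"; the $\mathsf{S4}$ principles for $\Box$: $\Box(\varphi\to\psi)\to(\Box\varphi\to\Box\psi)$, $\Box\varphi\to\varphi$, $\Box\varphi\to\Box\Box\varphi$, and the rule "from $\vdash\varphi$ infer $\vdash\Box\varphi$"; the schemes $(\mathrm{KI})$ $K\varphi\to\Box\varphi$; $(\mathrm{K}_B)$ $B(\varphi\to\psi)\to(B\varphi\to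 B\psi)$; $(\mathrm{sPI})$ $B\varphi\to KB\varphi$; $(\mathrm{KB})$ $K\varphi\to B\varphi$; $(\mathrm{RB})$ $B\varphi\to B\Box\varphi$. E-d semantics. A topological subset model is a triple $\mathcal{X}=(X,\mathcal{T},v)$ where $X$ is a nonempty set, $\mathcal{T}$ is a topology on $X$, and $v:\mathrm{PROP}\to 2^X$. An e-d scenario of $\mathcal{X}$ is a tuple $(x,U,V)$ with $x\in U$, $U,V\in\mathcal{T}$ and $V\subseteq U$ (neither $x\in V$ nor $V\neq\emptyset$ is required). With $[\![\varphi]\!]^{U,V}=\{y\in U : (\mathcal{X},y,U,V)\models\varphi\}$ and $\mathit{int}$ the interior in $(X,\mathcal{T})$, truth is defined by: $(\mathcal{X},x,U,V)\models p$ iff $x\in v(p)$; the usual clauses for $\neg$ and $\wedge$; $(\mathcal{X},x,U,V)\models K\varphi$ iff $U=[\![\varphi]\!]^{U,V}$; $(\mathcal{X},x,U,V)\models\Box\varphi$ iff $x\in\mathit{int}([\![\varphi]\!]^{U,V})$; $(\mathcal{X},x,U,V)\models B\varphi$ iff $V\subseteq[\![\varphi]\!]^{U,V}$. -}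

module Defs where

open import Data.Bool.Base using (Bool; true; not) renaming (_∧_ to _&&_)
open import Data.Product.Base using (_×_; Σ-syntax)
open import Level using (Level; Lift; _⊔_) renaming (suc to lsuc)
open import Relation.Binary.PropositionalEquality.Core using (_≡_)
open import Relation.Nullary.Negation.Core using (¬_)
open import Relation.Unary using (Pred; _∈_; _⊆_; _≐_; _∩_; ⋃)
open import Relation.Unary.Polymorphic using (∅) renaming (U to Whole)

infix  20 ∼_
infixr 15 _∧_
infixr 10 _⇒_
infix  4  ⊢_

data Form (PROP : Set) : Set where
  var : PROP → Form PROP
  ∼_  : Form PROP → Form PROP
  _∧_ : Form PROP → Form PROP → Form PROP
  K   : Form PROP → Form PROP
  □   : Form PROP → Form PROP
  B   : Form PROP → Form PROP

_⇒_ : {PROP : Set} → Form PROP → Form PROP → Form PROP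
φ ⇒ ψ = ∼ (φ ∧ ∼ ψ)

-- Boolean evaluation in which every formula whose main connective is not
-- ∼ or ∧ counts as a propositional atom, with truth value given by a.
eval : {PROP : Set} → (Form PROP → Bool) → Form PROP → Bool
eval a (var p) = a (var p)
eval a (∼ φ)   = not (eval a φ)
eval a (φ ∧ ψ) = eval a φ && eval a ψ
eval a (K φ)   = a (K φ)
eval a (□ φ)   = a (□ φ)
eval a (B φ)   = a (B φ)

-- Substitution instances of classical propositional tautologies.
Tautology : {PROP : Set} → Form PROP → Set
Tautology {PROP} φ = (a : Form PROP → Bool) → eval a φ ≡ true

data ⊢_ {PROP : Set} : Form PROP → Set where
  taut : ∀ {φ} → Tautology φ → ⊢ φ
  mp   : ∀ {φ ψ} → ⊢ (φ ⇒ ψ) → ⊢ φ → ⊢ ψ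

  K-K   : ∀ {φ ψ} → ⊢ (K (φ ⇒ ψ) ⇒ K φ ⇒ K ψ)
  K-T   : ∀ {φ} → ⊢ (K φ ⇒ φ)
  K-4   : ∀ {φ} → ⊢ (K φ ⇒ K (K φ))
  K-5   : ∀ {φ} → ⊢ (∼ K φ ⇒ K (∼ K φ))
  K-nec : ∀ {φ} → ⊢ φ → ⊢ K φ

  □-K   : ∀ {φ ψ} → ⊢ (□ (φ ⇒ ψ) ⇒ □ φ ⇒ □ ψ)
  □-T   : ∀ {φ} → ⊢ (□ φ ⇒ φ)
  □-4   : ∀ {φ} → ⊢ (□ φ ⇒ □ (□ φ))
  □-nec : ∀ {φ} → ⊢ φ → ⊢ □ φ

  KI  : ∀ {φ} → ⊢ (K φ ⇒ □ φ)
  B-K : ∀ {φ ψ} → ⊢ (B (φ ⇒ ψ) ⇒ B φ ⇒ B ψ)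
  sPI : ∀ {φ} → ⊢ (B φ ⇒ K (B φ))
  KB  : ∀ {φ} → ⊢ (K φ ⇒ B φ)
  RB  : ∀ {φ} → ⊢ (B φ ⇒ B (□ φ))

-- A set of subsets respects extensional equality ≐ of subsets; since ≐ is
-- not ≡ for predicates, this has to be required explicitly.
record Topology {ℓ : Level} (X : Set ℓ) : Set (lsuc (lsuc ℓ)) where
  field
    Open       : Pred (Pred X ℓ) (lsuc ℓ)
    Open-resp  : ∀ {P Q} → P ≐ Q → Open P → Open Q
    Open-∅     : Open ∅
    Open-whole : Open Whole
    Open-∩     : ∀ {P Q} → Open P → Open Q → Open (P ∩ Q)
    Open-⋃     : (I : Set ℓ) (P : I → Pred X ℓ) → (∀ i → Open (P i)) → Open (⋃ I P)

  -- The union of all open sets contained in S.  The level of S is arbitrary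
  -- because the truth set of a formula lives one universe above the opens.
  int : ∀ {s} → Pred X s → Pred X (lsuc ℓ ⊔ s)
  int S x = Σ[ O ∈ Pred X ℓ ] Open O × O ⊆ S × x ∈ O

record Model (PROP : Set) (ℓ : Level) : Set (lsuc (lsuc ℓ)) where
  field
    X        : Set ℓ
    nonempty : X
    topology : Topology X
    v        : PROP → Pred X ℓ
  open Topology topology public

module _ {PROP : Set} {ℓ : Level} (M : Model PROP ℓ) where
  open Model M

  record IsScenario (x : X) (U V : Pred X ℓ) : Set (lsuc ℓ) where
    field
      x∈U    : x ∈ U
      U-open : Open U
      V-open : Open V
      V⊆U    : V ⊆ U

  -- Defined for all triples x, U, V, but only meaningful for scenarios.  The
  -- clauses stay within scenarios because ⟦ φ ⟧ U V is restricted to U.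
  mutual
    Sat : X → Pred X ℓ → Pred X ℓ → Form PROP → Set (lsuc ℓ)
    Sat x U V (var p) = Lift (lsuc ℓ) (x ∈ v p)
    Sat x U V (∼ φ)   = ¬ Sat x U V φ
    Sat x U V (φ ∧ ψ) = Sat x U V φ × Sat x U V ψ
    Sat x U V (K φ)   = U ≐ ⟦ φ ⟧ U V
    Sat x U V (□ φ)   = x ∈ int (⟦ φ ⟧ U V)
    Sat x U V (B φ)   = V ⊆ ⟦ φ ⟧ U V

    ⟦_⟧ : Form PROP → Pred X ℓ → Pred X ℓ → Pred X (lsuc ℓ)
    ⟦ φ ⟧ U V y = y ∈ U × Sat y U V φ

Valid : {PROP : Set} (ℓ : Level) → Form PROP → Set (lsuc (lsuc ℓ))
Valid {PROP} ℓ φ =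
  (M : Model PROP ℓ) (x : Model.X M) (U V : Pred (Model.X M) ℓ) →
  IsScenario M x U V → Sat M x U V φ

{-# OPTIONS --safe #-}
-- Completeness is by a canonical model.  A formula χ that is not derivable fails
-- in some maximal theory w₀.  The points are the maximal theories with the same
-- K-formulas as w₀, the opens are the sets closed under the accessibility
-- relation of □, U is the whole space, and V is the set of theories containing
-- every φ with B φ ∈ w₀; the axiom RB makes V open.
module Submission where

open import Defs
open import Axiom.ExcludedMiddle using (ExcludedMiddle)
open import Data.Bool.Base using (Bool; true; false; not)
open import Data.Bool.Properties using (not-¬; ¬-not)
open import Data.Nat.Base using (ℕ; zero; _≤_; _⊔_; _≤′_; ≤′-refl; ≤′-step)
open import Data.Nat.Properties using (suc-injective; ≤⇒≤′; m≤m⊔n; m≤n⊔m)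
open import Data.Product.Base using (_×_; _,_; proj₁; proj₂; Σ-syntax; ∃-syntax)
open import Data.Sum.Base using (inj₁; inj₂; [_,_])
open import Data.Unit.Polymorphic.Base using (tt)
open import Function.Base using (_∘_; id)
open import Function.Bundles using (_⇔_; _↣_; mk⇔; module Injection)
open import Level using (Level; Lift; lift; lower; suc)
open import Relation.Binary.PropositionalEquality.Core
  using (_≡_; refl; sym; trans; cong; cong₂)
open import Relation.Nullary.Decidable
  using (Dec; yes; no; does; map′; decidable-stable; dec-true; dec-false)
open import Relation.Nullary.Negation.Core using (¬_; contradiction)
open import Relation.Unary using (Pred; _∈_; _⊆_; _∪_; ｛_｝)
open import Relation.Unary.Polymorphic using (∅) renaming (U to Whole)

-- Injective coding of formulas by natural numbers.

double : ℕ → ℕ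
double zero      = zero
double (ℕ.suc n) = ℕ.suc (ℕ.suc (double n))

double-injective : ∀ m n → double m ≡ double n → m ≡ n
double-injective zero      zero      _ = refl
double-injective (ℕ.suc m) (ℕ.suc n) e =
  cong ℕ.suc (double-injective m n (suc-injective (suc-injective e)))

double≢1+double : ∀ m n → ¬ double m ≡ ℕ.suc (double n)
double≢1+double (ℕ.suc m) (ℕ.suc n) e =
  double≢1+double m n (suc-injective (suc-injective e))

-- pair m n = 2 ^ m * (2 * n + 1)
pair : ℕ → ℕ → ℕ
pair zero      n = ℕ.suc (double n)
pair (ℕ.suc m) n = double (pair m n)

pair-injective : ∀ m {n} m′ {n′} → pair m n ≡ pair m′ n′ → m ≡ m′ × n ≡ n′
pair-injective zero      zero       e = refl , double-injective _ _ (suc-injective e)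
pair-injective zero      (ℕ.suc m′) e = contradiction (sym e) (double≢1+double _ _)
pair-injective (ℕ.suc m) zero       e = contradiction e (double≢1+double _ _)
pair-injective (ℕ.suc m) (ℕ.suc m′) e
  with refl , n≡n′ ← pair-injective m m′ (double-injective _ _ e) = refl , n≡n′

module _ {PROP : Set} (f : PROP ↣ ℕ) where
  open Injection f using (to; injective)

  tag : Form PROP → ℕ
  tag (var _) = 0
  tag (∼ _)   = 1
  tag (_ ∧ _) = 2
  tag (K _)   = 3
  tag (□ _)   = 4
  tag (B _)   = 5

  mutual
    code : Form PROP → ℕ
    code φ = pair (tag φ) (args φ)

    args : Form PROP → ℕ
    args (var p) = to p
    args (∼ φ)   = code φ
    args (φ ∧ ψ) = pair (code φ) (code ψ)
    args (K φ)   = code φ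
    args (□ φ)   = code φ
    args (B φ)   = code φ

  mutual
    code-injective : ∀ φ ψ → code φ ≡ code ψ → φ ≡ ψ
    code-injective φ ψ e with s , t ← pair-injective (tag φ) (tag ψ) e =
      tag-args-injective φ ψ s t

    -- Taking equal tags as a hypothesis leaves only the six cases with the same main connective.
    tag-args-injective : ∀ φ ψ → tag φ ≡ tag ψ → args φ ≡ args ψ → φ ≡ ψ
    tag-args-injective (var p) (var q)   refl e = cong var (injective e)
    tag-args-injective (∼ φ)   (∼ ψ)     refl e = cong ∼_ (code-injective φ ψ e)
    tag-args-injective (φ ∧ ψ) (φ′ ∧ ψ′) refl e
      with s , t ← pair-injective (code φ) (code φ′) e =
      cong₂ _∧_ (code-injective φ φ′ s) (code-injective ψ ψ′ t)
    tag-args-injective (K φ)   (K ψ)     refl e = cong K (code-injective φ ψ e)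
    tag-args-injective (□ φ)   (□ ψ)     refl e = cong □ (code-injective φ ψ e)
    tag-args-injective (B φ)   (B ψ)     refl e = cong B (code-injective φ ψ e)

-- Derivations from hypotheses and the deduction theorem.

module _ {PROP : Set} where

  infix 4 _⊩_

  -- Necessitation does not apply to hypotheses, so that the deduction theorem holds.
  data _⊩_ (Γ : Pred (Form PROP) Level.zero) : Form PROP → Set where
    hyp : ∀ {φ} → φ ∈ Γ → Γ ⊩ φ
    thm : ∀ {φ} → ⊢ φ → Γ ⊩ φ
    app : ∀ {φ ψ} → Γ ⊩ φ ⇒ ψ → Γ ⊩ φ → Γ ⊩ ψ

  ⊩-mono : ∀ {Γ Δ φ} → Γ ⊆ Δ → Γ ⊩ φ → Δ ⊩ φ
  ⊩-mono i (hyp h)   = hyp (i h)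
  ⊩-mono i (thm d)   = thm d
  ⊩-mono i (app d e) = app (⊩-mono i d) (⊩-mono i e)

  ∅⊩⇒⊢ : ∀ {φ} → ∅ ⊩ φ → ⊢ φ
  ∅⊩⇒⊢ (thm d)   = d
  ∅⊩⇒⊢ (app d e) = mp (∅⊩⇒⊢ d) (∅⊩⇒⊢ e)

  ⊢-const : (φ ψ : Form PROP) → ⊢ φ ⇒ ψ ⇒ φ
  ⊢-const φ ψ = taut t
    where
    t : Tautology (φ ⇒ ψ ⇒ φ)
    t a with eval a φ | eval a ψ
    ... | true  | true  = refl
    ... | true  | false = refl
    ... | false | _     = refl

  ⊢-ap : (φ ψ χ : Form PROP) → ⊢ (φ ⇒ ψ ⇒ χ) ⇒ (φ ⇒ ψ) ⇒ φ ⇒ χ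
  ⊢-ap φ ψ χ = taut t
    where
    t : Tautology ((φ ⇒ ψ ⇒ χ) ⇒ (φ ⇒ ψ) ⇒ φ ⇒ χ)
    t a with eval a φ | eval a ψ | eval a χ
    ... | true  | true  | true  = refl
    ... | true  | true  | false = refl
    ... | true  | false | _     = refl
    ... | false | _     | _     = refl

  ⊢-refl : (φ : Form PROP) → ⊢ φ ⇒ φ
  ⊢-refl φ = mp (mp (⊢-ap φ (φ ⇒ φ) φ) (⊢-const φ (φ ⇒ φ))) (⊢-const φ φ)

  ⊢-explosion : (φ χ : Form PROP) → ⊢ φ ⇒ ∼ φ ⇒ χ
  ⊢-explosion φ χ = taut t
    where
    t : Tautology (φ ⇒ ∼ φ ⇒ χ)
    t a with eval a φ
    ... | true  = refl
    ... | false = refl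

  ⊢-cases : (φ χ : Form PROP) → ⊢ (φ ⇒ χ) ⇒ (∼ φ ⇒ χ) ⇒ χ
  ⊢-cases φ χ = taut t
    where
    t : Tautology ((φ ⇒ χ) ⇒ (∼ φ ⇒ χ) ⇒ χ)
    t a with eval a φ | eval a χ
    ... | true  | true  = refl
    ... | true  | false = refl
    ... | false | true  = refl
    ... | false | false = refl

  ⊢-∧-intro : (φ ψ : Form PROP) → ⊢ φ ⇒ ψ ⇒ φ ∧ ψ
  ⊢-∧-intro φ ψ = taut t
    where
    t : Tautology (φ ⇒ ψ ⇒ φ ∧ ψ)
    t a with eval a φ | eval a ψ
    ... | true  | true  = refl
    ... | true  | false = refl
    ... | false | _     = refl

  ⊢-∧-elimˡ : (φ ψ : Form PROP) → ⊢ φ ∧ ψ ⇒ φ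
  ⊢-∧-elimˡ φ ψ = taut t
    where
    t : Tautology (φ ∧ ψ ⇒ φ)
    t a with eval a φ | eval a ψ
    ... | true  | true  = refl
    ... | true  | false = refl
    ... | false | _     = refl

  ⊢-∧-elimʳ : (φ ψ : Form PROP) → ⊢ φ ∧ ψ ⇒ ψ
  ⊢-∧-elimʳ φ ψ = taut t
    where
    t : Tautology (φ ∧ ψ ⇒ ψ)
    t a with eval a φ | eval a ψ
    ... | true  | true  = refl
    ... | true  | false = refl
    ... | false | _     = refl

  deduction : ∀ {Γ φ ψ} → Γ ∪ ｛ φ ｝ ⊩ ψ → Γ ⊩ φ ⇒ ψ
  deduction (hyp (inj₁ h))    = app (thm (⊢-const _ _)) (hyp h)
  deduction (hyp (inj₂ refl)) = thm (⊢-refl _)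
  deduction (thm d)           = thm (mp (⊢-const _ _) d)
  deduction (app d e)         = app (app (thm (⊢-ap _ _ _)) (deduction d)) (deduction e)

does⇒ : {P : Set} (P? : Dec P) → does P? ≡ true → P
does⇒ (yes p) _ = p

module _ {ℓ : Level} (em : ExcludedMiddle (suc ℓ)) where

  -- Derivability and membership in theories live in `Set`, below the universe of `em`.
  em₀ : (P : Set) → Dec P
  em₀ P = map′ lower lift (em {Lift (suc ℓ) P})

  stable : {P : Set (suc ℓ)} → ¬ ¬ P → P
  stable = decidable-stable em

  -- The truth condition of an implication unfolds to ¬ (P × ¬ Q).
  ⇒-elim : {P Q : Set (suc ℓ)} → ¬ (P × ¬ Q) → P → Q
  ⇒-elim f s = stable λ ¬t → f (s , ¬t)

  module _ {PROP : Set} where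

    -- Soundness

    module _ {M : Model PROP ℓ} {U V : Pred (Model.X M) ℓ} where

      -- Truth at `x` respects `∼_` and `_∧_`, and `eval` treats every other formula as an atom. A
      -- tautology is thus true at `x` by taking this one valuation.
      eval-Sat : ∀ x φ → eval (λ ψ → does (em {Sat M x U V ψ})) φ ≡ does (em {Sat M x U V φ})
      eval-Sat x (var p) = refl
      eval-Sat x (∼ φ) rewrite eval-Sat x φ with em {Sat M x U V φ}
      ... | yes s = sym (dec-false em λ ¬s → ¬s s)
      ... | no ¬s = sym (dec-true em ¬s)
      eval-Sat x (φ ∧ ψ) rewrite eval-Sat x φ | eval-Sat x ψ
        with em {Sat M x U V φ} | em {Sat M x U V ψ}
      ... | yes s | yes t = sym (dec-true em (s , t))
      ... | yes s | no ¬t = sym (dec-false em (¬t ∘ proj₂))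
      ... | no ¬s | _     = sym (dec-false em (¬s ∘ proj₁))
      eval-Sat x (K φ) = refl
      eval-Sat x (□ φ) = refl
      eval-Sat x (B φ) = refl

      tautology-Sat : ∀ {x φ} → Tautology φ → Sat M x U V φ
      tautology-Sat {x} {φ} t = stable λ ¬s →
        contradiction (trans (sym (t _)) (trans (eval-Sat x φ) (dec-false em ¬s))) λ ()

    -- The clauses for `K` and `B` do not mention the point, so one proof serves at every point of
    -- `U`; this gives `K-4`, `K-5` and `sPI`.
    soundness : ∀ {φ} → ⊢ φ → Valid ℓ φ
    soundness (taut t) M x U V sc = tautology-Sat t
    soundness (mp d e) M x U V sc = ⇒-elim (soundness d M x U V sc) (soundness e M x U V sc)
    soundness K-K M x U V sc = λ (k , ¬⇒) → ¬⇒ λ (l , ¬Kψ) →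
      ¬Kψ ((λ u → u , ⇒-elim (proj₂ (proj₁ k u)) (proj₂ (proj₁ l u))) , proj₁)
    soundness K-T M x U V sc = λ (k , ¬φ) → ¬φ (proj₂ (proj₁ k (IsScenario.x∈U sc)))
    soundness K-4 M x U V sc = λ (k , ¬KK) → ¬KK ((λ u → u , k) , proj₁)
    soundness K-5 M x U V sc = λ (¬k , ¬K¬K) → ¬K¬K ((λ u → u , ¬k) , proj₁)
    soundness (K-nec d) M x U V sc =
      (λ {y} u → u , soundness d M y U V record
        { x∈U = u ; U-open = U-open ; V-open = V-open ; V⊆U = V⊆U }) , proj₁
      where open IsScenario sc
    soundness □-K M x U V sc = λ ((O , o , i , p) , ¬⇒) → ¬⇒ λ ((O′ , o′ , i′ , p′) , ¬□ψ) →
      ¬□ψ (_ , Model.Open-∩ M o o′ ,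
        (λ (q , q′) → proj₁ (i q) , ⇒-elim (proj₂ (i q)) (proj₂ (i′ q′))) , p , p′)
    soundness □-T M x U V sc = λ ((O , o , i , p) , ¬φ) → ¬φ (proj₂ (i p))
    soundness □-4 M x U V sc = λ ((O , o , i , p) , ¬□□) →
      -- `O` is a neighbourhood of each of its points, so it witnesses both interiors.
      ¬□□ (O , o , (λ q → proj₁ (i q) , O , o , i , q) , p)
    soundness (□-nec d) M x U V sc =
      U , U-open ,
      (λ {y} u → u , soundness d M y U V record
        { x∈U = u ; U-open = U-open ; V-open = V-open ; V⊆U = V⊆U }) , x∈U
      where open IsScenario sc
    soundness KI M x U V sc = λ (k , ¬□φ) → ¬□φ (U , U-open , proj₁ k , x∈U)
      where open IsScenario sc
    soundness B-K M x U V sc = λ (b , ¬⇒) → ¬⇒ λ (c , ¬Bψ) →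
      ¬Bψ λ v → proj₁ (b v) , ⇒-elim (proj₂ (b v)) (proj₂ (c v))
    soundness sPI M x U V sc = λ (b , ¬KB) → ¬KB ((λ u → u , b) , proj₁)
    soundness KB M x U V sc = λ (k , ¬Bφ) → ¬Bφ λ v → proj₁ k (IsScenario.V⊆U sc v)
    -- `V` is open and lies in the truth set, so it witnesses `□` at each of its points.
    soundness RB M x U V sc = λ (b , ¬B□) → ¬B□ λ v → V⊆U v , V , V-open , b , v
      where open IsScenario sc

    -- Maximal theories and Lindenbaum's lemma.

    -- The representation by Booleans keeps theories in Set, as the points of a
    -- model at level ℓ = 0 require.
    record Theory : Set where
      field
        holds    : Form PROP → Bool
        closed   : ∀ {φ} → (λ ψ → holds ψ ≡ true) ⊩ φ → holds φ ≡ true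
        negation : ∀ φ → holds (∼ φ) ≡ not (holds φ)
    open Theory

    infix 4 _∋_

    _∋_ : Theory → Form PROP → Set
    w ∋ φ = holds w φ ≡ true

    ∋-⊢ : ∀ w {φ ψ} → ⊢ φ ⇒ ψ → w ∋ φ → w ∋ ψ
    ∋-⊢ w d h = closed w (app (thm d) (hyp h))

    ∋∼⇒∌ : ∀ w {φ} → w ∋ ∼ φ → ¬ w ∋ φ
    ∋∼⇒∌ w {φ} h k with () ← trans (sym h) (trans (negation w φ) (cong not k))

    ∌⇒∋∼ : ∀ w {φ} → ¬ w ∋ φ → w ∋ ∼ φ
    ∌⇒∋∼ w {φ} h = trans (negation w φ) (cong not (¬-not h))

    module _ (f : PROP ↣ ℕ) where

      -- Non-derivability of a fixed χ replaces consistency: there is no constant ⊥.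
      module Lindenbaum (Γ : Pred (Form PROP) Level.zero) (χ : Form PROP) (Γ⊮χ : ¬ Γ ⊩ χ) where

        -- Step `n` considers the formula with code `n`. Phrased as a condition on codes, this calls
        -- for no decoding: a number that codes nothing adds nothing.
        stage : ℕ → Pred (Form PROP) Level.zero
        stage zero      = Γ
        stage (ℕ.suc n) =
          stage n ∪ (λ φ → code f φ ≡ n × ¬ stage n ∪ ｛ φ ｝ ⊩ χ)

        limit : Pred (Form PROP) Level.zero
        limit φ = ∃[ n ] φ ∈ stage n

        stage-mono′ : ∀ {m n} → m ≤′ n → stage m ⊆ stage n
        stage-mono′ ≤′-refl     = id
        stage-mono′ (≤′-step i) = inj₁ ∘ stage-mono′ i

        stage-mono : ∀ {m n} → m ≤ n → stage m ⊆ stage n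
        stage-mono i = stage-mono′ (≤⇒≤′ i)

        compactness : ∀ {φ} → limit ⊩ φ → ∃[ n ] stage n ⊩ φ
        compactness (hyp (n , h)) = n , hyp h
        compactness (thm d)       = 0 , thm d
        compactness (app d e) with m , d′ ← compactness d | n , e′ ← compactness e =
          m ⊔ n , app (⊩-mono (stage-mono (m≤m⊔n m n)) d′) (⊩-mono (stage-mono (m≤n⊔m m n)) e′)

        stage⊮χ : ∀ n → ¬ stage n ⊩ χ
        stage⊮χ zero d = Γ⊮χ d
        stage⊮χ (ℕ.suc n) d
          with em₀ (∃[ φ ] (code f φ ≡ n × ¬ stage n ∪ ｛ φ ｝ ⊩ χ))
        -- Injectivity of the code makes `φ` the only formula added here, and `¬e` says that adding
        -- it keeps `χ` underivable.
        ... | yes (φ , refl , ¬e) =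
          ¬e (⊩-mono [ inj₁ , (λ (s , _) → inj₂ (sym (code-injective f _ _ s))) ] d)
        ... | no none = stage⊮χ n (⊩-mono [ id , (λ h → contradiction (_ , h) none) ] d)

        limit⊮χ : ¬ limit ⊩ χ
        limit⊮χ d with n , e ← compactness d = stage⊮χ n e

        -- `φ` is considered at stage `code f φ`: if adding it would give `χ`, the deduction theorem
        -- applies; otherwise it belongs to the next stage.
        limit-maximal : ∀ {φ} → ¬ limit ⊩ φ → limit ⊩ φ ⇒ χ
        limit-maximal {φ} ¬d with em₀ (stage (code f φ) ∪ ｛ φ ｝ ⊩ χ)
        ... | yes e = ⊩-mono (λ h → code f φ , h) (deduction e)
        ... | no ¬e = contradiction (hyp (ℕ.suc (code f φ) , inj₂ (refl , ¬e))) ¬d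

        limit-dec : ∀ φ → Dec (limit ⊩ φ)
        limit-dec φ = em₀ (limit ⊩ φ)

        ∈⇒⊩ : ∀ {φ} → does (limit-dec φ) ≡ true → limit ⊩ φ
        ∈⇒⊩ {φ} = does⇒ (limit-dec φ)

        cut : ∀ {φ} → (λ ψ → does (limit-dec ψ) ≡ true) ⊩ φ → limit ⊩ φ
        cut (hyp h)   = ∈⇒⊩ h
        cut (thm d)   = thm d
        cut (app d e) = app (cut d) (cut e)

        limit-negation : ∀ φ → does (limit-dec (∼ φ)) ≡ not (does (limit-dec φ))
        limit-negation φ = negate (limit-dec φ)
          where
          negate : (φ? : Dec (limit ⊩ φ)) → does (limit-dec (∼ φ)) ≡ not (does φ?)
          negate (yes d) = dec-false (limit-dec _) λ e →
            limit⊮χ (app (app (thm (⊢-explosion _ _)) d) e)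
          -- If neither `φ` nor `∼ φ` were derivable, maximality would make both imply `χ`, and so
          -- derive `χ`.
          negate (no ¬d) = dec-true (limit-dec _) (decidable-stable (limit-dec _) λ ¬e →
            limit⊮χ (app (app (thm (⊢-cases φ χ)) (limit-maximal ¬d)) (limit-maximal ¬e)))

        -- Its members are the formulas derivable from `limit`, so closure is an instance of cut.
        theory : Theory
        theory = record
          { holds    = λ φ → does (limit-dec φ)
          ; closed   = λ d → dec-true (limit-dec _) (cut d)
          ; negation = limit-negation
          }

      lindenbaum : ∀ {Γ χ} → ¬ Γ ⊩ χ → Σ[ w ∈ Theory ] (∀ {φ} → φ ∈ Γ → w ∋ φ) × ¬ w ∋ χ
      lindenbaum {Γ} {χ} Γ⊮χ =
        theory , (λ h → dec-true (limit-dec _) (hyp (0 , h))) , λ h → limit⊮χ (∈⇒⊩ h)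
        where open Lindenbaum Γ χ Γ⊮χ

      -- The canonical model

      Acc : (Form PROP → Form PROP) → Theory → Theory → Set
      Acc M w x = ∀ {φ} → w ∋ M φ → x ∋ φ

      module _ {M : Form PROP → Form PROP}
               (M-K : ∀ {φ ψ} → ⊢ M (φ ⇒ ψ) ⇒ M φ ⇒ M ψ)
               (M-nec : ∀ {φ} → ⊢ φ → ⊢ M φ) where

        -- A normal modality can be applied to a whole derivation: necessitation handles theorems,
        -- distribution handles modus ponens.
        boxed : ∀ {w φ} → (λ ψ → w ∋ M ψ) ⊩ φ → w ∋ M φ
        boxed     (hyp h)   = h
        boxed {w} (thm d)   = closed w (thm (M-nec d))
        boxed {w} (app d e) = closed w (app (app (thm M-K) (hyp (boxed {w} d))) (hyp (boxed {w} e)))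

        existence : ∀ {w φ} → ¬ w ∋ M φ → Σ[ x ∈ Theory ] Acc M w x × ¬ x ∋ φ
        existence {w} ∌ = lindenbaum λ d → ∌ (boxed {w} d)

      _≈K_ : Theory → Theory → Set
      w ≈K x = ∀ φ → holds w (K φ) ≡ holds x (K φ)

      -- `K-4` passes on the `K`-formulas of `w` and `K-5` the negations of those absent, so
      -- agreement holds both ways.
      Acc-K⇒≈K : ∀ {w x} → Acc K w x → w ≈K x
      Acc-K⇒≈K {w} {x} r φ with holds w (K φ) in e
      ... | true  = sym (r (∋-⊢ w K-4 e))
      ... | false = sym (¬-not (∋∼⇒∌ x (r (∋-⊢ w K-5 (∌⇒∋∼ w λ h → not-¬ h e)))))

      -- `sPI` turns `B φ` into the `K`-formula `K (B φ)`, which the two theories share.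
      B-introspective : ∀ {w x φ} → w ≈K x → w ∋ B φ → x ∋ B φ
      B-introspective {w} {x} {φ} w≈x h = ∋-⊢ x K-T (trans (sym (w≈x (B φ))) (∋-⊢ w sPI h))

      module Canonical (w₀ : Theory) where

        Point : Set ℓ
        Point = Lift ℓ (Σ[ w ∈ Theory ] w₀ ≈K w)

        th : Point → Theory
        th x = proj₁ (lower x)

        w₀≈ : ∀ x → w₀ ≈K th x
        w₀≈ x = proj₂ (lower x)

        point : ∀ w → w₀ ≈K w → Point
        point w w₀≈w = lift (w , w₀≈w)

        canonical : Model PROP ℓ
        canonical = record
          { X        = Point
          ; nonempty = point w₀ λ _ → refl
          ; topology = record
            { Open       = λ P → Lift (suc ℓ) (∀ {x y} → Acc □ (th x) (th y) → x ∈ P → y ∈ P)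
            ; Open-resp  = λ (i , j) (lift o) → lift λ r p → i (o r (j p))
            ; Open-∅     = lift λ _ ()
            ; Open-whole = lift λ _ _ → tt
            ; Open-∩     = λ (lift o) (lift o′) → lift λ r (p , p′) → o r p , o′ r p′
            ; Open-⋃     = λ I P o → lift λ r (i , p) → i , lower (o i) r p
            }
          ; v        = λ p x → Lift ℓ (th x ∋ var p)
          }

        V : Pred Point ℓ
        V x = Lift ℓ (Acc B w₀ (th x))

        scenario : ∀ x → IsScenario canonical x Whole V
        scenario x = record
          { x∈U    = tt
          ; U-open = lift λ _ _ → tt
          -- By `RB`, a point of `V` contains `□ φ` whenever `w₀` contains `B φ`, so its successors
          -- contain `φ`.
          ; V-open = lift λ r (lift b) → lift λ h → r (b (∋-⊢ w₀ RB h))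
          ; V⊆U    = λ _ → tt
          }

        mutual
          -- The two directions of the truth lemma are mutually recursive since negation
          -- interchanges them.
          truth⁺ : ∀ φ x → th x ∋ φ → Sat canonical x Whole V φ
          truth⁺ (var p) x h = lift (lift h)
          truth⁺ (∼ φ)   x h = λ s → ∋∼⇒∌ (th x) h (truth⁻ φ x s)
          truth⁺ (φ ∧ ψ) x h =
            truth⁺ φ x (∋-⊢ (th x) (⊢-∧-elimˡ φ ψ) h) , truth⁺ ψ x (∋-⊢ (th x) (⊢-∧-elimʳ φ ψ) h)
          truth⁺ (K φ) x h =
            (λ {y} _ → tt , truth⁺ φ y
              (∋-⊢ (th y) K-T (trans (sym (w₀≈ y φ)) (trans (w₀≈ x φ) h)))) ,
            λ _ → tt
          truth⁺ (□ φ) x h =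
            -- The smallest open neighbourhood of `x`: `□-4` makes it open and `□-T` puts `x` in it.
            (λ y → Lift ℓ (Acc □ (th x) (th y))) ,
            lift (λ r (lift s) → lift λ k → r (s (∋-⊢ (th x) □-4 k))) ,
            (λ {y} (lift r) → tt , truth⁺ φ y (r h)) ,
            lift (∋-⊢ (th x) □-T)
          truth⁺ (B φ) x h {y} (lift b) =
            tt , truth⁺ φ y (b (B-introspective {th x} {w₀} (λ ψ → sym (w₀≈ x ψ)) h))

          truth⁻ : ∀ φ x → Sat canonical x Whole V φ → th x ∋ φ
          truth⁻ (var p) x (lift (lift h)) = h
          truth⁻ (∼ φ)   x ¬s = ∌⇒∋∼ (th x) λ h → ¬s (truth⁺ φ x h)
          truth⁻ (φ ∧ ψ) x (s , t) =
            closed (th x) (app (app (thm (⊢-∧-intro φ ψ)) (hyp (truth⁻ φ x s))) (hyp (truth⁻ ψ x t)))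
          truth⁻ (K φ) x (s , _) = decidable-stable (em₀ _) λ ∌ →
            let y , r , y∌ = existence K-K K-nec {th x} ∌
                p = point y λ ψ → trans (w₀≈ x ψ) (Acc-K⇒≈K {th x} {y} r ψ)
            in y∌ (truth⁻ φ p (proj₂ (s {p} tt)))
          truth⁻ (□ φ) x (O , lift o , i , q) = decidable-stable (em₀ _) λ ∌ →
            let y , r , y∌ = existence □-K □-nec {th x} ∌
                -- `KI` makes the `□`-successor `y` a `K`-successor, hence a point.
                p = point y λ ψ → trans (w₀≈ x ψ) (Acc-K⇒≈K {th x} {y} (λ h → r (∋-⊢ (th x) KI h)) ψ)
            in y∌ (truth⁻ φ p (proj₂ (i {p} (o r q))))
          -- `V` is defined from `w₀`, so the argument runs at `w₀` and its result is carried over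
          -- to `x`.
          truth⁻ (B φ) x s = B-introspective {w₀} {th x} (w₀≈ x) (decidable-stable (em₀ _) λ ∌ →
            -- `KB` serves twice: it derives necessitation for `B`, and it makes every `B`-successor
            -- of `w₀` a point.
            let y , r , y∌ = existence B-K (mp KB ∘ K-nec) {w₀} ∌
                p = point y (Acc-K⇒≈K {w₀} {y} λ h → r (∋-⊢ w₀ KB h))
            in y∌ (truth⁻ φ p (proj₂ (s {p} (lift r)))))

      completeness : ∀ {φ} → Valid ℓ φ → ⊢ φ
      completeness {φ} valid = decidable-stable (em₀ _) λ ⊬φ →
        let w₀ , _ , w₀∌φ = lindenbaum (⊬φ ∘ ∅⊩⇒⊢)
            open Canonical w₀
            x = point w₀ λ _ → refl
        in w₀∌φ (truth⁻ φ x (valid canonical x Whole V (scenario x)))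

theorem8 : (ℓ : Level) → ExcludedMiddle (suc ℓ) →
    (PROP : Set) → PROP ↣ ℕ →
    (φ : Form PROP) → (⊢ φ) ⇔ Valid ℓ φ
theorem8 ℓ em PROP f φ = mk⇔ (soundness em) (completeness em f)
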